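{- Let $A$ be a finite set. The alternating revital $Even(A)=\bigcup_{n}\mathrm{Alt}(A^n)$ is finitely generated, i.e. there is a finite set $P\subseteq B(A)$ with $\lceil P\rceil = Even(A)$. Moreover, the even permutations of $A^4$ generate all even permutations of $A^n$ for all $n\geq 4$, i.e. $\mathrm{Alt}(A^n)\subseteq\lceil \mathrm{Alt}(A^4)\rceil$ for every $n\ge 4$.
   Context: For a finite set $A$ and a positive integer $n$, $B_n(A)=\mathrm{Sym}(A^n)$ is the group of bijections $A^n\to A^n$ and $B(A)=\bigcup_n B_n(A)$; its elements are called gates. $\mathrm{Alt}(A^n)$ is the group of even permutations of the finite set $A^n$. For $\alpha\in S_n$, the wire permutation is $\pi_\alpha(x_1,\dots,x_n)=(x_{\alpha^{ -1}(1)},\dots,x_{\alpha^{ -1}(n)})$; a rewiring of $f\in B_n(A)$ is $\pi_\alpha\circ f\circ\pi_\alpha^{ -1}$ for some $\alpha\in S_n$. For $f\in B_n(A)$, $g\in B_m(A)$, $f\oplus g\in B_{n+m}(A)$ applies $f$ to the first $n$ coordinates and $g$ to the last $m$; $\mathrm{id}_k$ is the identity of $A^k$. The extensions of $f\in B_\ell(A)$ on $A^n$, $n\ge\ell$, are the rewirings of $f\oplus \mathrm{id}_{n-\ell}$. For $P\subseteq B(A)$, $\lceil P\rceil\subseteq B(A)$ is the set of all gates obtained from $\mathrm{id}_1$ and the elements of $P$ by compositions of gates of equal arity and extensions. A set $C\subseteq B(A)$ with $C=\lceil C\rceil$ is called a revital; it is finitely generated if $C=\lceil P\rceil$ for some finite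 $P$. -}

module Defs where

open import Data.Fin.Permutation as Perm using (Permutation′; _⟨$⟩ˡ_)
open import Data.List.Base using (List; foldr; length)
open import Data.List.Relation.Unary.All using (All)
import Data.List.Membership.Setoid as Membership
open import Data.Nat.Base using (ℕ; suc; _+_; NonZero)
open import Data.Nat.Divisibility using (_∣_)
open import Data.Product.Base using (_×_; _,_; proj₁; proj₂; Σ-syntax; ∃-syntax)
open import Data.Vec.Base using (Vec; _++_; take; drop; lookup; tabulate)
open import Data.Vec.Properties
  using (lookup∘tabulate; tabulate∘lookup; tabulate-cong; take++drop≡id; ++-injective)
open import Function.Base using (_∘_)
open import Function.Bundles using (_↔_; Inverse; mk↔ₛ′)
open import Function.Construct.Composition using (_↔-∘_)
open import Function.Construct.Identity using (↔-id)
open import Function.Construct.Symmetry using (↔-sym)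
open import Level using (Level; _⊔_)
open import Relation.Binary.Bundles using (Setoid)
open import Relation.Binary.PropositionalEquality
  using (_≡_; _≢_; _≗_; refl; sym; trans; cong; cong₂; module ≡-Reasoning)
open import Relation.Unary using (Pred; _∈_; _≐_; ⋃)

private
  variable
    a p : Level

open Inverse using (to; from; strictlyInverseˡ; strictlyInverseʳ)

Sym : Set a → Set a
Sym X = X ↔ X

------------------------------------------------------------------------
-- Even permutations

record IsTransposition {X : Set a} (f : Sym X) : Set a where
  field
    i j   : X
    i≢j   : i ≢ j
    i↦j   : to f i ≡ j
    j↦i   : to f j ≡ i
    fixes : ∀ x → x ≢ i → x ≢ j → to f x ≡ x

composite : {X : Set a} → List (Sym X) → Sym X
composite = foldr _↔-∘_ (↔-id _)

IsEven : {X : Set a} → Sym X → Set a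
IsEven {X = X} f =
  Σ[ ts ∈ List (Sym X) ]
    All IsTransposition ts × 2 ∣ length ts × to f ≗ to (composite ts)

------------------------------------------------------------------------
-- Wire permutations, rewirings, parallel composition, extensions

module _ {A : Set a} where

  wire : ∀ {n} → Permutation′ n → Sym (Vec A n)
  wire {n} α = mk↔ₛ′ (permute α) (permute (Perm.flip α))
    (λ xs → permute-∘ α (Perm.flip α) xs λ i → Perm.inverseʳ α)
    (λ xs → permute-∘ (Perm.flip α) α xs λ i → Perm.inverseˡ α)
    where
    permute : Permutation′ n → Vec A n → Vec A n
    permute β xs = tabulate (λ i → lookup xs (β ⟨$⟩ˡ i))

    permute-∘ : ∀ β γ xs → (∀ i → γ ⟨$⟩ˡ (β ⟨$⟩ˡ i) ≡ i) →
                permute β (permute γ xs) ≡ xs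
    permute-∘ β γ xs eq = trans
      (tabulate-cong λ i → trans
        (lookup∘tabulate (λ j → lookup xs (γ ⟨$⟩ˡ j)) (β ⟨$⟩ˡ i))
        (cong (lookup xs) (eq i)))
      (tabulate∘lookup xs)

  rewire : ∀ {n} → Permutation′ n → Sym (Vec A n) → Sym (Vec A n)
  rewire α f = wire α ↔-∘ (f ↔-∘ ↔-sym (wire α))

  infixr 6 _⊕_

  _⊕_ : ∀ {m n} → Sym (Vec A m) → Sym (Vec A n) → Sym (Vec A (m + n))
  _⊕_ {m} {n} f g = mk↔ₛ′ (apply f g) (apply (↔-sym f) (↔-sym g))
    (apply-∘ f g (↔-sym f) (↔-sym g) (strictlyInverseˡ f) (strictlyInverseˡ g))
    (apply-∘ (↔-sym f) (↔-sym g) f g (strictlyInverseʳ f) (strictlyInverseʳ g))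
    where
    apply : Sym (Vec A m) → Sym (Vec A n) → Vec A (m + n) → Vec A (m + n)
    apply f g xs = to f (take m xs) ++ to g (drop m xs)

    apply-∘ : ∀ f g f′ g′ → to f ∘ to f′ ≗ (λ x → x) → to g ∘ to g′ ≗ (λ x → x) →
              apply f g ∘ apply f′ g′ ≗ (λ x → x)
    apply-∘ f g f′ g′ ff′ gg′ xs = begin
      to f (take m ys) ++ to g (drop m ys)
        ≡⟨ cong₂ (λ u v → to f u ++ to g v) (proj₁ split) (proj₂ split) ⟩
      to f (to f′ (take m xs)) ++ to g (to g′ (drop m xs))
        ≡⟨ cong₂ _++_ (ff′ _) (gg′ _) ⟩
      take m xs ++ drop m xs
        ≡⟨ take++drop≡id m xs ⟩
      xs ∎
      where
      open ≡-Reasoning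
      ys = apply f′ g′ xs
      split = ++-injective (take m ys) (to f′ (take m xs)) (take++drop≡id m ys)

  extend : ∀ {ℓ} k → Permutation′ (ℓ + k) → Sym (Vec A ℓ) → Sym (Vec A (ℓ + k))
  extend k α f = rewire α (f ⊕ ↔-id (Vec A k))

------------------------------------------------------------------------
-- Gates

+-nonZero : ∀ m {n} .{{_ : NonZero m}} → NonZero (m + n)
+-nonZero (suc m) = _

record Gate (A : Set a) : Set a where
  constructor gate
  field
    arity       : ℕ
    .{{arity≢0}} : NonZero arity
    perm        : Sym (Vec A arity)

open Gate public

-- An inverse pair carries proofs, so two gates are identified when they have
-- the same arity and the same underlying function.

infix 4 _≈_

data _≈_ {A : Set a} : Gate A → Gate A → Set a where
  same : ∀ {n} .{{_ : NonZero n}} {f g : Sym (Vec A n)} →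
         to f ≗ to g → gate n f ≈ gate n g

gateSetoid : Set a → Setoid a a
gateSetoid A = record
  { Carrier       = Gate A
  ; _≈_           = _≈_
  ; isEquivalence = record
    { refl  = same λ _ → refl
    ; sym   = λ { (same e) → same (λ x → sym (e x)) }
    ; trans = λ { (same {{n≢0}} e) (same e′) → same {{n≢0}} (λ x → trans (e x) (e′ x)) }
    }
  }

------------------------------------------------------------------------
-- Generated gate sets

data ⌈_⌉ {A : Set a} (P : Pred (Gate A) p) : Pred (Gate A) (a ⊔ p) where
  id₁  : gate 1 (↔-id (Vec A 1)) ∈ ⌈ P ⌉
  gen  : ∀ {g} → g ∈ P → g ∈ ⌈ P ⌉
  comp : ∀ {n} .{{_ : NonZero n}} {f g : Sym (Vec A n)} →
         gate n f ∈ ⌈ P ⌉ → gate n g ∈ ⌈ P ⌉ → gate n (f ↔-∘ g) ∈ ⌈ P ⌉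
  ext  : ∀ {ℓ} .{{_ : NonZero ℓ}} {f : Sym (Vec A ℓ)} k (α : Permutation′ (ℓ + k)) →
         gate ℓ f ∈ ⌈ P ⌉ → gate (ℓ + k) {{+-nonZero ℓ}} (extend k α f) ∈ ⌈ P ⌉
  resp : ∀ {g h} → g ≈ h → g ∈ ⌈ P ⌉ → h ∈ ⌈ P ⌉

FinitelyGenerated : {A : Set a} → Pred (Gate A) p → Set (a ⊔ p)
FinitelyGenerated {A = A} C = ∃[ gs ] ⌈ (λ g → g ∈ₗ gs) ⌉ ≐ C
  where open Membership (gateSetoid A) renaming (_∈_ to _∈ₗ_)

-- Alt A 0 has no elements, because gates have positive arity.

Alt : (A : Set a) → ℕ → Pred (Gate A) a
Alt A n g = arity g ≡ n × IsEven (perm g)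

Even : (A : Set a) → Pred (Gate A) a
Even A = ⋃[ n ∶ ℕ ] Alt A n

{-# OPTIONS --safe #-}

-- An even permutation is a product of pairs of transpositions, so arities up to 4
-- need finitely many generators; the point is to pass from arity n ≥ 4 to n + 1.
-- Let F and G be 3-cycles of n-letter words, extended so that F ignores the first and
-- G the last of n + 1 letters. If a single word s is moved by both, then their
-- commutator is the 3-cycle on s, F s, G s. This yields the 3-cycles on words
-- x k y, x l y′, x′ m y with first and last letters x, x′, y, y′ and any distinct
-- middle parts k, l, m. Call two transpositions linked if their product is generated;
-- a 3-cycle links the transpositions along the edges of its triangle, and these
-- triangles suffice to link all transpositions of words.

module Submission where

open import Defs
open import Data.Fin.Base using (Fin; zero; suc; _↑ˡ_; _↑ʳ_; splitAt)
open import Data.Fin.Permutation as Perm using (Permutation′; _⟨$⟩ˡ_)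
import Data.Fin.Permutation.Components as PC
open import Data.Fin.Properties as Fin using (join-splitAt)
open import Data.List.Base as List
  using (List; []; _∷_; length; map; filter; concatMap; cartesianProduct; cartesianProductWith;
         allFin; upTo)
open import Data.List.Membership.Propositional as List using (find; lose)
open import Data.List.Membership.Propositional.Properties
  using (∈-allFin; ∈-upTo⁺; ∈-map⁺; ∈-filter⁺; ∈-filter⁻; ∈-cartesianProduct⁺;
         ∈-cartesianProductWith⁺; ∈-cartesianProductWith⁻; ∈-concatMap⁺; ∈-concatMap⁻)
import Data.List.Membership.Setoid as Membership
open import Data.List.Properties using (length-++; length-map)
open import Data.List.Relation.Unary.All as All using (All; []; _∷_)
import Data.List.Relation.Unary.All.Properties as All
open import Data.List.Relation.Unary.Any using (here; there)
open import Data.List.Relation.Unary.Unique.Propositional using (Unique; []; _∷_)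
import Data.List.Relation.Unary.Unique.Propositional.Properties as Unique
open import Data.Nat.Base using (ℕ; zero; suc; _+_; _*_; _≤_; _<_; z≤n; s≤s; NonZero)
open import Data.Nat.Divisibility using (_∣_; _∣0; ∣⇒≤; ∣m+n∣m⇒∣n; ∣m∣n⇒∣m+n; ∣m⇒∣m*n; ∣-refl)
open import Data.Nat.Properties using (+-comm; _<?_; ≮⇒≥; m≤n⇒∃[o]m+o≡n)
open import Data.Product.Base using (_×_; _,_; proj₁; proj₂; ∃-syntax; ∃₂)
open import Data.Sum.Base using (_⊎_; inj₁; inj₂)
open import Data.Vec.Base using (Vec; []; _∷_; _++_; take; drop; lookup)
open import Data.Vec.Properties
  using (≡-dec; ∷-injective; ∷-injectiveˡ; ∷-injectiveʳ; ++-injective; take++drop≡id;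
         lookup-++ˡ; lookup-++ʳ; tabulate-cong; tabulate∘lookup)
open import Function.Base using (_∘_; id)
open import Function.Bundles using (_↔_; Inverse; mk↔ₛ′)
open import Function.Construct.Composition using (_↔-∘_)
open import Function.Construct.Identity using (↔-id)
open import Function.Construct.Symmetry using (↔-sym)
open import Function.Properties.Inverse using (↔⇒↣)
open import Relation.Binary.Bundles using (Setoid)
open import Relation.Binary.Definitions using (DecidableEquality)
open import Relation.Binary.PropositionalEquality
  using (_≡_; _≢_; _≗_; refl; sym; trans; cong; cong₂; subst; ≢-sym; module ≡-Reasoning)
open import Relation.Nullary using (Dec; yes; no; contradiction; ¬?)
open import Relation.Nullary.Decidable using (dec-true; dec-false)
open import Relation.Unary using (Pred; _∈_; _⊆_)

open Inverse using (to; from; strictlyInverseˡ; strictlyInverseʳ)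

-- Transpositions, and 3-cycles obtained as commutators

to-injective : ∀ {a b} {X : Set a} {Y : Set b} (f : X ↔ Y) →
               ∀ {x y} → to f x ≡ to f y → x ≡ y
to-injective f eq =
  trans (sym (strictlyInverseʳ f _)) (trans (cong (from f) eq) (strictlyInverseʳ f _))

module Swap {a} {X : Set a} (_≟_ : DecidableEquality X) where

  exchange : X → X → X → X
  exchange x y z with z ≟ x | z ≟ y
  ... | yes _ | _     = y
  ... | no _  | yes _ = x
  ... | no _  | no _  = z

  exchangeˡ : ∀ x y → exchange x y x ≡ y
  exchangeˡ x y with x ≟ x
  ... | yes _  = refl
  ... | no x≢x = contradiction refl x≢x

  exchangeʳ : ∀ x y → exchange x y y ≡ x
  exchangeʳ x y with y ≟ x | y ≟ y
  ... | yes y≡x | _      = y≡x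
  ... | no _    | yes _  = refl
  ... | no _    | no y≢y = contradiction refl y≢y

  exchange-fixes : ∀ {x y z} → z ≢ x → z ≢ y → exchange x y z ≡ z
  exchange-fixes {x} {y} {z} z≢x z≢y with z ≟ x | z ≟ y
  ... | yes z≡x | _       = contradiction z≡x z≢x
  ... | no _    | yes z≡y = contradiction z≡y z≢y
  ... | no _    | no _    = refl

  locate : ∀ x y z → z ≡ x ⊎ z ≡ y ⊎ (z ≢ x × z ≢ y)
  locate x y z with z ≟ x | z ≟ y
  ... | yes z≡x | _       = inj₁ z≡x
  ... | no _    | yes z≡y = inj₂ (inj₁ z≡y)
  ... | no z≢x  | no z≢y  = inj₂ (inj₂ (z≢x , z≢y))

  -- Lets an arbitrary `IsTransposition` be replaced by the `transposition` of the two points it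
  -- moves.
  exchange-unique : ∀ {x y} {h : X → X} → h x ≡ y → h y ≡ x →
                    (∀ z → z ≢ x → z ≢ y → h z ≡ z) → h ≗ exchange x y
  exchange-unique {x} {y} hx hy fix z with locate x y z
  ... | inj₁ refl                = trans hx (sym (exchangeˡ _ y))
  ... | inj₂ (inj₁ refl)         = trans hy (sym (exchangeʳ x _))
  ... | inj₂ (inj₂ (z≢x , z≢y)) = trans (fix z z≢x z≢y) (sym (exchange-fixes z≢x z≢y))

  exchange-involutive : ∀ x y z → exchange x y (exchange x y z) ≡ z
  exchange-involutive x y z with locate x y z
  ... | inj₁ refl                = trans (cong (exchange _ y) (exchangeˡ _ y)) (exchangeʳ _ y)
  ... | inj₂ (inj₁ refl)         = trans (cong (exchange x _) (exchangeʳ x _)) (exchangeˡ x _)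
  ... | inj₂ (inj₂ (z≢x , z≢y)) = trans (cong (exchange x y) fixed) fixed
    where fixed = exchange-fixes z≢x z≢y

  exchange-comm : ∀ x y → exchange x y ≗ exchange y x
  exchange-comm x y = exchange-unique (exchangeʳ x y) (exchangeˡ x y)
    (λ z z≢y z≢x → exchange-fixes z≢x z≢y)

  exchange-conj : ∀ {σ : X → X} → (∀ {u v} → σ u ≡ σ v → u ≡ v) → ∀ x y z →
                  σ (exchange x y z) ≡ exchange (σ x) (σ y) (σ z)
  exchange-conj {σ} inj x y z with locate x y z
  ... | inj₁ refl                = trans (cong σ (exchangeˡ _ y)) (sym (exchangeˡ _ _))
  ... | inj₂ (inj₁ refl)         = trans (cong σ (exchangeʳ x _)) (sym (exchangeʳ _ _))
  ... | inj₂ (inj₂ (z≢x , z≢y)) =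
    trans (cong σ (exchange-fixes z≢x z≢y)) (sym (exchange-fixes (z≢x ∘ inj) (z≢y ∘ inj)))

  transposition : X → X → Sym X
  transposition x y = mk↔ₛ′ (exchange x y) (exchange x y)
    (exchange-involutive x y) (exchange-involutive x y)

  transposition-isTransposition : ∀ {x y} → x ≢ y → IsTransposition (transposition x y)
  transposition-isTransposition {x} {y} x≢y = record
    { i = x ; j = y ; i≢j = x≢y
    ; i↦j = exchangeˡ x y ; j↦i = exchangeʳ x y ; fixes = λ _ → exchange-fixes }

  -- Conjugating the swap of `y` and `z` by the swap of `x` and `y` renames `y` to `x`. This turns
  -- one factorization of a 3-cycle into two transpositions into another.
  exchange-shift : ∀ {x y z} → z ≢ x → z ≢ y →
                   exchange x y ∘ exchange y z ≗ exchange x z ∘ exchange x y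
  exchange-shift {x} {y} {z} z≢x z≢y w = trans
    (exchange-conj (to-injective (transposition x y)) y z w)
    (cong₂ (λ u v → exchange u v (exchange x y w)) (exchangeʳ x y) (exchange-fixes z≢x z≢y))

  module _ (f g : Sym X) (s : X) where

    commutator : Sym X
    commutator = f ↔-∘ (g ↔-∘ (↔-sym f ↔-∘ ↔-sym g))

    -- The supports of f and g meet in s only, so the commutator is the 3-cycle
    -- g s ↦ s ↦ f s ↦ g s.
    commutator-3-cycle : (∀ z → to f z ≡ z ⊎ to g z ≡ z ⊎ z ≡ s) →
                         to f s ≢ s → to g s ≢ s →
                         to commutator ≗ exchange s (to f s) ∘ exchange (to f s) (to g s)
    commutator-3-cycle meet x≢s y≢s z = go (z ≟ s) (z ≟ x) (z ≟ y)
      where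
      open ≡-Reasoning
      x = to f s
      y = to g s
      r = from g s

      from-fixed : ∀ (h : Sym X) {w} → to h w ≡ w → from h w ≡ w
      from-fixed h {w} hw≡w = to-injective h (trans (strictlyInverseˡ h w) (sym hw≡w))

      f-fixes : ∀ {w} → w ≢ s → to g w ≢ w → to f w ≡ w
      f-fixes {w} w≢s gw≢w with meet w
      ... | inj₁ fw≡w        = fw≡w
      ... | inj₂ (inj₁ gw≡w) = contradiction gw≡w gw≢w
      ... | inj₂ (inj₂ w≡s)  = contradiction w≡s w≢s

      fx≢x : to f x ≢ x
      fx≢x = x≢s ∘ to-injective f

      gx≡x : to g x ≡ x
      gx≡x with meet x
      ... | inj₁ fx≡x        = contradiction fx≡x fx≢x
      ... | inj₂ (inj₁ gx≡x) = gx≡x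
      ... | inj₂ (inj₂ x≡s)  = contradiction x≡s x≢s

      fy≡y : to f y ≡ y
      fy≡y = f-fixes y≢s (y≢s ∘ to-injective g)

      x≢y : x ≢ y
      x≢y x≡y = fx≢x (trans (cong (to f) x≡y) (trans fy≡y (sym x≡y)))

      gr≡s : to g r ≡ s
      gr≡s = strictlyInverseˡ g s

      r≢s : r ≢ s
      r≢s r≡s = y≢s (trans (cong (to g) (sym r≡s)) gr≡s)

      fr≡r : to f r ≡ r
      fr≡r = f-fixes r≢s (λ gr≡r → r≢s (trans (sym gr≡r) gr≡s))

      to-commutator-fixed : ∀ {w} → w ≢ s → w ≢ x → w ≢ y → to commutator w ≡ w
      to-commutator-fixed {w} w≢s w≢x w≢y with meet w
      ... | inj₂ (inj₂ w≡s)  = contradiction w≡s w≢s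
      -- It is enough that `g` fixes the preimage `v` of `w` under `f`: if `f` fixes `v` then `v` is
      -- `w`, and `v ≡ s` would make `w` equal to `to f s`. The other case is the mirror image, with
      -- `f` and `g` exchanged.
      ... | inj₂ (inj₁ gw≡w) = begin
        to f (to g (from f (from g w)))  ≡⟨ cong (to f ∘ to g ∘ from f) (from-fixed g gw≡w) ⟩
        to f (to g (from f w))           ≡⟨ cong (to f) g-fixes ⟩
        to f (from f w)                  ≡⟨ strictlyInverseˡ f w ⟩
        w                                ∎
        where
        v = from f w
        fv≡w = strictlyInverseˡ f w
        g-fixes : to g v ≡ v
        g-fixes with meet v
        ... | inj₁ fv≡v        = subst (λ u → to g u ≡ u) (trans (sym fv≡w) fv≡v) gw≡w
        ... | inj₂ (inj₁ gv≡v) = gv≡v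
        ... | inj₂ (inj₂ v≡s)  = contradiction (trans (sym fv≡w) (cong (to f) v≡s)) w≢x
      ... | inj₁ fw≡w = begin
        to f (to g (from f v))  ≡⟨ cong (to f ∘ to g) (from-fixed f fv≡v) ⟩
        to f (to g v)           ≡⟨ cong (to f) gv≡w ⟩
        to f w                  ≡⟨ fw≡w ⟩
        w                       ∎
        where
        v = from g w
        gv≡w = strictlyInverseˡ g w
        fv≡v : to f v ≡ v
        fv≡v with meet v
        ... | inj₁ fv≡v        = fv≡v
        ... | inj₂ (inj₁ gv≡v) = subst (λ u → to f u ≡ u) (trans (sym gv≡w) gv≡v) fw≡w
        ... | inj₂ (inj₂ v≡s)  = contradiction (trans (sym gv≡w) (cong (to g) v≡s)) w≢y

      go : ∀ {z} → Dec (z ≡ s) → Dec (z ≡ x) → Dec (z ≡ y) →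
           to commutator z ≡ exchange s x (exchange x y z)
      go (yes refl) _ _ = begin
        to f (to g (from f r))         ≡⟨ cong (to f ∘ to g) (from-fixed f fr≡r) ⟩
        to f (to g r)                  ≡⟨ cong (to f) gr≡s ⟩
        x                              ≡⟨ exchangeˡ s x ⟨
        exchange s x s                 ≡⟨ cong (exchange s x) s-fixed ⟨
        exchange s x (exchange x y s)  ∎
        where s-fixed = exchange-fixes (≢-sym x≢s) (≢-sym y≢s)
      go (no _) (yes refl) _ = begin
        to f (to g (from f (from g x)))  ≡⟨ cong (to f ∘ to g ∘ from f) (from-fixed g gx≡x) ⟩
        to f (to g (from f x))           ≡⟨ cong (to f ∘ to g) (strictlyInverseʳ f s) ⟩
        to f y                           ≡⟨ fy≡y ⟩
        y                                ≡⟨ exchange-fixes y≢s (≢-sym x≢y) ⟨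
        exchange s x y                   ≡⟨ cong (exchange s x) (exchangeˡ x y) ⟨
        exchange s x (exchange x y x)    ∎
      go (no _) (no _) (yes refl) = begin
        to f (to g (from f (from g y)))  ≡⟨ cong (to f ∘ to g ∘ from f) (strictlyInverseʳ g s) ⟩
        to f (to g (from f s))           ≡⟨ cong (to f) g-fixes ⟩
        to f (from f s)                  ≡⟨ strictlyInverseˡ f s ⟩
        s                                ≡⟨ exchangeʳ s x ⟨
        exchange s x x                   ≡⟨ cong (exchange s x) (exchangeʳ x y) ⟨
        exchange s x (exchange x y y)    ∎
        where
        t = from f s
        ft≡s = strictlyInverseˡ f s
        t≢s : t ≢ s
        t≢s t≡s = x≢s (trans (cong (to f) (sym t≡s)) ft≡s)
        g-fixes : to g t ≡ t
        g-fixes with meet t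
        ... | inj₁ ft≡t        = contradiction (trans (sym ft≡t) ft≡s) t≢s
        ... | inj₂ (inj₁ gt≡t) = gt≡t
        ... | inj₂ (inj₂ t≡s)  = contradiction t≡s t≢s
      go (no z≢s) (no z≢x) (no z≢y) = trans
        (to-commutator-fixed z≢s z≢x z≢y)
        (sym (trans (cong (exchange s x) (exchange-fixes z≢x z≢y)) (exchange-fixes z≢s z≢x)))

-- Closure properties of even permutations and induction over them

module _ {a} {X : Set a} where

  composite-++ : ∀ (ss ts : List (Sym X)) →
                 to (composite (ss List.++ ts)) ≗ to (composite ss) ∘ to (composite ts)
  composite-++ []       ts x = refl
  composite-++ (s ∷ ss) ts x = cong (to s) (composite-++ ss ts x)

  even-cong : {f g : Sym X} → to f ≗ to g → IsEven f → IsEven g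
  even-cong f≗g (ts , all , 2∣ , eq) = ts , all , 2∣ , λ x → trans (sym (f≗g x)) (eq x)

  even-id : IsEven (↔-id X)
  even-id = [] , [] , 2 ∣0 , λ _ → refl

  even-∘ : {f g : Sym X} → IsEven f → IsEven g → IsEven (f ↔-∘ g)
  even-∘ {f} (ss , all-ss , 2∣ss , f≗) (ts , all-ts , 2∣ts , g≗) =
    ss List.++ ts ,
    All.++⁺ all-ss all-ts ,
    subst (2 ∣_) (sym (length-++ ss)) (∣m∣n⇒∣m+n 2∣ss 2∣ts) ,
    λ x → trans (trans (cong (to f) (g≗ x)) (f≗ _)) (sym (composite-++ ss ts x))

  pair-isEven : {s t : Sym X} → IsTransposition s → IsTransposition t → IsEven (s ↔-∘ t)
  pair-isEven {s} {t} s-tr t-tr = s ∷ t ∷ [] , s-tr ∷ t-tr ∷ [] , ∣-refl , λ _ → refl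

  module _ {p} (Q : Sym X → Set p) (Q-resp : ∀ f g → to f ≗ to g → Q f → Q g)
           (Q-id : Q (↔-id X)) (Q-∘ : ∀ f g → Q f → Q g → Q (f ↔-∘ g)) where

    -- An even number of factors can be grouped into consecutive pairs, so a property closed under
    -- composition only has to be checked on products of two transpositions.
    even-induction : (∀ s t → IsTransposition s → IsTransposition t → Q (s ↔-∘ t)) →
                     ∀ f → IsEven f → Q f
    even-induction Q-pair f (ts , all , 2∣ , f≗) =
      Q-resp (composite ts) f (λ x → sym (f≗ x)) (go ts all 2∣)
      where
      go : ∀ ts → All IsTransposition ts → 2 ∣ length ts → Q (composite ts)
      go []           _                    _  = Q-id
      go (_ ∷ [])     _                    2∣ with ∣⇒≤ 2∣
      ... | s≤s ()
      go (s ∷ t ∷ ts) (s-tr ∷ t-tr ∷ all) 2∣ =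
        Q-resp ((s ↔-∘ t) ↔-∘ composite ts) (composite (s ∷ t ∷ ts)) (λ _ → refl)
          (Q-∘ (s ↔-∘ t) (composite ts) (Q-pair s t s-tr t-tr) (go ts all (∣m+n∣m⇒∣n 2∣ ∣-refl)))

-- Evenness of a permutation that acts on one factor of a product

-- A permutation of X acting on Y ≅ X × V with V finite: every transposition of X
-- becomes |V| transpositions of Y, one for each element of V.
module Parallel {a b c} {X : Set a} {V : Set b} {Y : Set c} (_≟_ : DecidableEquality Y)
  (ρ : X → V → Y) (ρ-injective : ∀ {x v y w} → ρ x v ≡ ρ y w → x ≡ y × v ≡ w)
  (ρ-surjective : ∀ y → ∃₂ λ x v → y ≡ ρ x v)
  (vs : List V) (vs-unique : Unique vs) (vs-complete : ∀ v → v List.∈ vs) where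

  open Swap _≟_

  module _ {t : Sym X} (t-tr : IsTransposition t) where
    open IsTransposition t-tr

    copy : V → Sym Y
    copy v = transposition (ρ i v) (ρ j v)

    copies : List V → List (Sym Y)
    copies = map copy

    copy-acts : ∀ x v → to (copy v) (ρ x v) ≡ ρ (to t x) v
    copy-acts x v with locate (ρ i v) (ρ j v) (ρ x v)
    ... | inj₁ eq with refl ← proj₁ (ρ-injective eq) =
      trans (exchangeˡ _ _) (cong (λ y → ρ y v) (sym i↦j))
    ... | inj₂ (inj₁ eq) with refl ← proj₁ (ρ-injective eq) =
      trans (exchangeʳ _ _) (cong (λ y → ρ y v) (sym j↦i))
    ... | inj₂ (inj₂ (≢i , ≢j)) =
      trans (exchange-fixes ≢i ≢j)
        (cong (λ y → ρ y v) (sym (fixes x (λ { refl → ≢i refl }) (λ { refl → ≢j refl }))))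

    copy-fixes : ∀ x {v w} → v ≢ w → to (copy v) (ρ x w) ≡ ρ x w
    copy-fixes x v≢w = exchange-fixes (v≢w ∘ sym ∘ proj₂ ∘ ρ-injective)
                                      (v≢w ∘ sym ∘ proj₂ ∘ ρ-injective)

    copies-isTransposition : ∀ ws → All IsTransposition (copies ws)
    copies-isTransposition []       = []
    copies-isTransposition (w ∷ ws) =
      transposition-isTransposition (i≢j ∘ proj₁ ∘ ρ-injective) ∷ copies-isTransposition ws

    copies-fix : ∀ x {w ws} → All (w ≢_) ws → to (composite (copies ws)) (ρ x w) ≡ ρ x w
    copies-fix x []           = refl
    copies-fix x (w≢v ∷ w≢vs) =
      trans (cong (to (copy _)) (copies-fix x w≢vs)) (copy-fixes x (≢-sym w≢v))

    -- Copies for different elements of `V` move disjoint sets, so only the copy of `w` matters at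
    -- `ρ x w`; uniqueness of the list makes it occur exactly once.
    copies-act : ∀ x {w ws} → Unique ws → w List.∈ ws →
                 to (composite (copies ws)) (ρ x w) ≡ ρ (to t x) w
    copies-act x (w∉ ∷ _)       (here refl) =
      trans (cong (to (copy _)) (copies-fix x w∉)) (copy-acts x _)
    copies-act x (v∉ ∷ unique) (there w∈)  =
      trans (cong (to (copy _)) (copies-act x unique w∈))
            (copy-fixes _ (All.lookup v∉ w∈))

  -- Replacing each factor of `f` by its copies multiplies the number of factors by the size of `V`.
  -- An even number stays even, whatever the parity of that size.
  parallel-even : (F : Sym Y) (f : Sym X) → (∀ x v → to F (ρ x v) ≡ ρ (to f x) v) →
                  IsEven f → IsEven F
  parallel-even F f F-acts (ts , all , 2∣ , f≗) =
    lift all , lift-isTransposition all ,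
    subst (2 ∣_) (sym (length-lift all)) (∣m⇒∣m*n (length vs) 2∣) , F≗
    where
    lift : ∀ {ts : List (Sym X)} → All IsTransposition ts → List (Sym Y)
    lift []           = []
    lift (t-tr ∷ all) = copies t-tr vs List.++ lift all

    lift-isTransposition : ∀ {ts : List (Sym X)} (all : All IsTransposition ts) →
                           All IsTransposition (lift all)
    lift-isTransposition []           = []
    lift-isTransposition (t-tr ∷ all) =
      All.++⁺ (copies-isTransposition t-tr vs) (lift-isTransposition all)

    length-lift : ∀ {ts : List (Sym X)} (all : All IsTransposition ts) →
                  length (lift all) ≡ length ts * length vs
    length-lift []           = refl
    length-lift (t-tr ∷ all) = trans (length-++ (copies t-tr vs))
      (cong₂ _+_ (length-map (copy t-tr) vs) (length-lift all))

    lift-acts : ∀ {ts : List (Sym X)} (all : All IsTransposition ts) x v →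
                to (composite (lift all)) (ρ x v) ≡ ρ (to (composite ts) x) v
    lift-acts []           x v = refl
    lift-acts (t-tr ∷ all) x v = trans (composite-++ (copies t-tr vs) (lift all) _)
      (trans (cong (to (composite (copies t-tr vs))) (lift-acts all x v))
             (copies-act t-tr _ vs-unique (vs-complete v)))

    F≗ : to F ≗ to (composite (lift all))
    F≗ y with x , v , refl ← ρ-surjective y = begin
      to F (ρ x v)                    ≡⟨ F-acts x v ⟩
      ρ (to f x) v                    ≡⟨ cong (λ z → ρ z v) (f≗ x) ⟩
      ρ (to (composite ts) x) v       ≡⟨ lift-acts all x v ⟨
      to (composite (lift all)) (ρ x v) ∎
      where open ≡-Reasoning

-- Index transpositions and the action of extended gates

↑ˡ≢↑ʳ : ∀ {m n} (i : Fin m) (k : Fin n) → i ↑ˡ n ≢ m ↑ʳ k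
↑ˡ≢↑ʳ zero    k ()
↑ˡ≢↑ʳ (suc i) k eq = ↑ˡ≢↑ʳ i k (Fin.suc-injective eq)

transposeˡ : ∀ {n} (i j : Fin n) → PC.transpose i j i ≡ j
transposeˡ i j rewrite dec-true (i Fin.≟ i) refl = refl

transpose-fixes : ∀ {n} {i j k : Fin n} → k ≢ i → k ≢ j → PC.transpose i j k ≡ k
transpose-fixes {i = i} {j} {k} k≢i k≢j
  rewrite dec-false (k Fin.≟ i) k≢i | dec-false (k Fin.≟ j) k≢j = refl

module _ {a} {A : Set a} where

  module _ {ℓ} k (α : Permutation′ (ℓ + k)) where

    -- Coordinates on words of length `ℓ + k` in which an extended gate acts on `x` and leaves `v`
    -- alone, as `Parallel` requires.
    extended : Vec A ℓ → Vec A k → Vec A (ℓ + k)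
    extended x v = to (wire α) (x ++ v)

    extended-injective : ∀ {x v y w} → extended x v ≡ extended y w → x ≡ y × v ≡ w
    extended-injective = ++-injective _ _ ∘ to-injective (wire α)

    extended-surjective : ∀ y → ∃₂ λ x v → y ≡ extended x v
    extended-surjective y = take ℓ z , drop ℓ z ,
      sym (trans (cong (to (wire α)) (take++drop≡id ℓ z)) (strictlyInverseˡ (wire α) y))
      where z = from (wire α) y

    extend-acts : ∀ f x v → to (extend k α f) (extended x v) ≡ extended (to f x) v
    extend-acts f x v = cong (to (wire α)) (trans
      (cong (λ z → to f (take ℓ z) ++ drop ℓ z) (strictlyInverseʳ (wire α) (x ++ v)))
      (cong₂ (λ y w → to f y ++ w) (proj₁ split) (proj₂ split)))
      where split = ++-injective (take ℓ (x ++ v)) x (take++drop≡id ℓ (x ++ v))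

  extend-id : ∀ {ℓ} k (α : Permutation′ (ℓ + k)) → to (extend k α (↔-id (Vec A ℓ))) ≗ id
  extend-id k α y with x , v , refl ← extended-surjective k α y = extend-acts k α (↔-id _) x v

  wire-id : ∀ {n} (x : Vec A n) → to (wire Perm.id) x ≡ x
  wire-id = tabulate∘lookup

-- Words split into first letter, middle part and last letter

module Words {a} (A : Set a) (j : ℕ) where

  -- The length is written `suc j + 1` because that is the arity `extend 1` gives to a gate of arity
  -- `suc j`.
  word : A → Vec A j → A → Vec A (suc j + 1)
  word x m y = (x ∷ m) ++ (y ∷ [])

  word-injective : ∀ {x m y x′ m′ y′} → word x m y ≡ word x′ m′ y′ →
                   x ≡ x′ × m ≡ m′ × y ≡ y′
  word-injective {m = m} {m′ = m′} eq =
    ∷-injectiveˡ eq , proj₁ eqs , ∷-injectiveˡ (proj₂ eqs)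
    where eqs = ++-injective m m′ (∷-injectiveʳ eq)

  data IsWord : Vec A (suc j + 1) → Set a where
    is-word : ∀ x m y → IsWord (word x m y)

  isWord : ∀ u → IsWord u
  isWord u with take (suc j) u | drop (suc j) u | take++drop≡id (suc j) u
  ... | x ∷ m | y ∷ [] | refl = is-word x m y

  ends : Permutation′ (suc j + 1)
  ends = Perm.transpose zero (suc (j ↑ʳ zero))

  wire-ends : ∀ x m y → to (wire ends) (word x m y) ≡ word y m x
  wire-ends x m y = trans (tabulate-cong pointwise) (tabulate∘lookup (word y m x))
    where
    pointwise : ∀ i → lookup (word x m y) (ends ⟨$⟩ˡ i) ≡ lookup (word y m x) i
    pointwise zero = lookup-++ʳ m (y ∷ []) zero
    pointwise (suc i) with splitAt j i | join-splitAt j 1 i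
    ... | inj₂ zero | refl =
      trans (cong (lookup (word x m y)) (transposeˡ (suc (j ↑ʳ zero)) zero))
            (sym (lookup-++ʳ m (x ∷ []) zero))
    ... | inj₁ k | refl =
      trans (cong (lookup (word x m y))
                  (transpose-fixes (↑ˡ≢↑ʳ k zero ∘ Fin.suc-injective) λ ()))
            (trans (lookup-++ˡ m (y ∷ []) k) (sym (lookup-++ˡ m (x ∷ []) k)))

  -- Rewiring by `ends` brings the last letter to the front, so under `omitFirst` the gate reads the
  -- last letter followed by the middle part.
  omitLast omitFirst : Sym (Vec A (suc j)) → Sym (Vec A (suc j + 1))
  omitLast  = extend 1 Perm.id
  omitFirst = extend 1 ends

  omitLast-acts : ∀ f {x m x′ m′} y → to f (x ∷ m) ≡ x′ ∷ m′ →
                  to (omitLast f) (word x m y) ≡ word x′ m′ y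
  omitLast-acts f {x} {m} {x′} {m′} y eq = begin
    to (omitLast f) (word x m y)                ≡⟨ cong (to (omitLast f)) (wire-id (word x m y)) ⟨
    to (omitLast f) (extended′ (x ∷ m) (y ∷ [])) ≡⟨ extend-acts 1 Perm.id f (x ∷ m) (y ∷ []) ⟩
    extended′ (to f (x ∷ m)) (y ∷ [])            ≡⟨ cong (λ z → extended′ z (y ∷ [])) eq ⟩
    extended′ (x′ ∷ m′) (y ∷ [])                 ≡⟨ wire-id (word x′ m′ y) ⟩
    word x′ m′ y                                ∎
    where
    open ≡-Reasoning
    extended′ = extended 1 Perm.id

  omitFirst-acts : ∀ f {y m y′ m′} x → to f (y ∷ m) ≡ y′ ∷ m′ →
                   to (omitFirst f) (word x m y) ≡ word x m′ y′
  omitFirst-acts f {y} {m} {y′} {m′} x eq = begin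
    to (omitFirst f) (word x m y)                ≡⟨ cong (to (omitFirst f)) (wire-ends y m x) ⟨
    to (omitFirst f) (extended′ (y ∷ m) (x ∷ [])) ≡⟨ extend-acts 1 ends f (y ∷ m) (x ∷ []) ⟩
    extended′ (to f (y ∷ m)) (x ∷ [])             ≡⟨ cong (λ z → extended′ z (x ∷ [])) eq ⟩
    extended′ (y′ ∷ m′) (x ∷ [])                  ≡⟨ wire-ends y′ m′ x ⟩
    word x m′ y′                                 ∎
    where
    open ≡-Reasoning
    extended′ = extended 1 ends

-- The 3-cycle sending `p` to `q`, `q` to `r` and `r` to `p`

module ThreeCycle {a} {X : Set a} (_≟_ : DecidableEquality X) {p q r : X}
  (p≢q : p ≢ q) (p≢r : p ≢ r) (q≢r : q ≢ r) where

  open Swap _≟_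

  3-cycle : Sym X
  3-cycle = transposition p q ↔-∘ transposition q r

  3-cycle-isEven : IsEven 3-cycle
  3-cycle-isEven =
    pair-isEven (transposition-isTransposition p≢q) (transposition-isTransposition q≢r)

  -- A commutator also needs inverses, and `⌈_⌉` has no constructor for them. The inverse is the
  -- product of the same two transpositions in reverse order, hence even itself.
  3-cycle⁻¹-isEven : IsEven (↔-sym 3-cycle)
  3-cycle⁻¹-isEven = even-cong
    {f = transposition q r ↔-∘ transposition p q} {g = ↔-sym 3-cycle} (λ _ → refl)
    (pair-isEven (transposition-isTransposition q≢r) (transposition-isTransposition p≢q))

  p↦q : to 3-cycle p ≡ q
  p↦q = trans (cong (exchange p q) (exchange-fixes p≢q p≢r)) (exchangeˡ p q)

  3-cycle-moves : ∀ z → to 3-cycle z ≡ z ⊎ z ≡ p ⊎ z ≡ q ⊎ z ≡ r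
  3-cycle-moves z with locate p q z | locate q r z
  ... | inj₁ z≡p               | _                      = inj₂ (inj₁ z≡p)
  ... | inj₂ (inj₁ z≡q)        | _                      = inj₂ (inj₂ (inj₁ z≡q))
  ... | _                      | inj₁ z≡q               = inj₂ (inj₂ (inj₁ z≡q))
  ... | _                      | inj₂ (inj₁ z≡r)        = inj₂ (inj₂ (inj₂ z≡r))
  ... | inj₂ (inj₂ (z≢p , _)) | inj₂ (inj₂ (z≢q , z≢r)) =
    inj₁ (trans (cong (exchange p q) (exchange-fixes z≢q z≢r)) (exchange-fixes z≢p z≢q))

-- Generated permutations and linked transpositions

module Generation {a p} {A : Set a} (_≟_ : DecidableEquality A) {P : Pred (Gate A) p} where

  _≟ᵛ_ : ∀ {n} → DecidableEquality (Vec A n)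
  _≟ᵛ_ = ≡-dec _≟_

  open module SwapVec {n} = Swap (_≟ᵛ_ {n})

  Generated : ∀ {n} .{{_ : NonZero n}} → Pred (Sym (Vec A n)) _
  Generated f = gate _ f ∈ ⌈ P ⌉

  Complete : ∀ n → .{{NonZero n}} → Set _
  Complete n = ∀ (f : Sym (Vec A n)) → IsEven f → Generated f

  complete-subst : ∀ {m n} .{{_ : NonZero m}} .{{_ : NonZero n}} → m ≡ n → Complete m → Complete n
  complete-subst refl complete = complete

  module _ {n} .{{_ : NonZero n}} where

    generated-cong : ∀ (f g : Sym (Vec A n)) → to f ≗ to g → Generated f → Generated g
    generated-cong f g f≗g = resp (same f≗g)

    generated-∘ : ∀ (f g : Sym (Vec A n)) → Generated f → Generated g → Generated (f ↔-∘ g)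
    generated-∘ f g = comp {f = f} {g = g}

    commutator-generated : ∀ (f g : Sym (Vec A n)) →
      Generated f → Generated (↔-sym f) → Generated g → Generated (↔-sym g) →
      ∀ {s u v} → (∀ z → to f z ≡ z ⊎ to g z ≡ z ⊎ z ≡ s) →
      to f s ≡ u → to g s ≡ v → u ≢ s → v ≢ s →
      Generated (transposition s u ↔-∘ transposition u v)
    commutator-generated f g f-gen f⁻¹-gen g-gen g⁻¹-gen {s} meet refl refl u≢s v≢s =
      generated-cong (commutator f g s) _ (commutator-3-cycle f g s meet u≢s v≢s)
        (generated-∘ f _ f-gen (generated-∘ g _ g-gen
          (generated-∘ (↔-sym f) (↔-sym g) f⁻¹-gen g⁻¹-gen)))

    infix 4 _—_~_—_

    -- The two products are inverse to each other. Asking for both makes the relation symmetric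
    -- without closure under inverses.
    _—_~_—_ : (u v x y : Vec A n) → Set _
    u — v ~ x — y = Generated (transposition u v ↔-∘ transposition x y) ×
                    Generated (transposition x y ↔-∘ transposition u v)

    pair-cong : ∀ {u v x y u′ v′ x′ y′ : Vec A n} →
                exchange u v ∘ exchange x y ≗ exchange u′ v′ ∘ exchange x′ y′ →
                Generated (transposition u v ↔-∘ transposition x y) →
                Generated (transposition u′ v′ ↔-∘ transposition x′ y′)
    pair-cong = generated-cong (transposition _ _ ↔-∘ transposition _ _)
                               (transposition _ _ ↔-∘ transposition _ _)

    ~-sym : ∀ {u v x y} → u — v ~ x — y → x — y ~ u — v
    ~-sym (uvxy , xyuv) = xyuv , uvxy

    ~-flip : ∀ {u v x y} → u — v ~ x — y → v — u ~ x — y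
    ~-flip {u} {v} {x} {y} (uvxy , xyuv) =
      pair-cong (λ z → exchange-comm u v (exchange x y z)) uvxy ,
      pair-cong (λ z → cong (exchange x y) (exchange-comm u v z)) xyuv

    -- The two adjacent copies of the middle transposition cancel.
    ~-trans : ∀ {u v x y x′ y′} → u — v ~ x — y → x — y ~ x′ — y′ → u — v ~ x′ — y′
    ~-trans (uvxy , xyuv) (xyx′y′ , x′y′xy) = cancel uvxy xyx′y′ , cancel x′y′xy xyuv
      where
      cancel : ∀ {u v x y x′ y′ : Vec A n} →
               Generated (transposition u v ↔-∘ transposition x y) →
               Generated (transposition x y ↔-∘ transposition x′ y′) →
               Generated (transposition u v ↔-∘ transposition x′ y′)
      cancel {u} {v} {x} {y} {x′} {y′} uvxy xyx′y′ = generated-cong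
        ((transposition u v ↔-∘ transposition x y) ↔-∘ (transposition x y ↔-∘ transposition x′ y′))
        (transposition u v ↔-∘ transposition x′ y′)
        (λ z → cong (exchange u v) (exchange-involutive x y (exchange x′ y′ z)))
        (generated-∘ _ _ uvxy xyx′y′)

    -- The hypotheses are a 3-cycle on `s`, `u`, `v` and its inverse. Each can be rewritten by
    -- `exchange-shift` as a product along any two edges of the triangle.
    triangle : ∀ {s u v} → u ≢ s → v ≢ s → u ≢ v →
               Generated (transposition s u ↔-∘ transposition u v) →
               Generated (transposition s v ↔-∘ transposition v u) →
               u — v ~ s — u × u — v ~ s — v
    triangle {s} {u} {v} u≢s v≢s u≢v su-uv sv-vu =
      (pair-cong (λ z → begin
         exchange s v (exchange v u z)  ≡⟨ exchange-comm s v (exchange v u z) ⟩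
         exchange v s (exchange v u z)  ≡⟨ exchange-shift (≢-sym v≢s) (≢-sym u≢s) z ⟨
         exchange v u (exchange u s z)  ≡⟨ exchange-comm v u (exchange u s z) ⟩
         exchange u v (exchange u s z)  ≡⟨ cong (exchange u v) (exchange-comm u s z) ⟩
         exchange u v (exchange s u z)  ∎) sv-vu ,
       su-uv) ,
      (pair-cong (λ z → begin
         exchange s u (exchange u v z)  ≡⟨ exchange-comm s u (exchange u v z) ⟩
         exchange u s (exchange u v z)  ≡⟨ exchange-shift (≢-sym u≢s) (≢-sym v≢s) z ⟨
         exchange u v (exchange v s z)  ≡⟨ cong (exchange u v) (exchange-comm v s z) ⟩
         exchange u v (exchange s v z)  ∎) su-uv ,
       pair-cong (λ z → cong (exchange s v) (exchange-comm v u z)) sv-vu)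
      where open ≡-Reasoning

    -- The product along `u — w` and `w — v` is a 3-cycle, which also factors through the third edge
    -- `u — v`. This reaches a transposition of two words with the same middle part.
    detour : ∀ {u v w} → v ≢ u → v ≢ w → u — w ~ w — v → u — v ~ u — w
    detour {u} {v} {w} v≢u v≢w (uw-wv , wv-uw) =
      pair-cong (exchange-shift v≢u v≢w) uw-wv ,
      pair-cong (λ z → begin
        exchange w v (exchange u w z)  ≡⟨ cong (exchange w v) (exchange-comm u w z) ⟩
        exchange w v (exchange w u z)  ≡⟨ exchange-shift v≢w v≢u z ⟨
        exchange w u (exchange u v z)  ≡⟨ exchange-comm w u (exchange u v z) ⟩
        exchange u w (exchange u v z)  ∎) wv-uw
      where open ≡-Reasoning

  generated-id : ∀ {n} .{{_ : NonZero n}} → Generated (↔-id (Vec A n))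
  generated-id {suc n} = generated-cong (extend n Perm.id (↔-id _)) (↔-id _) (extend-id n Perm.id)
    (ext {f = ↔-id _} n Perm.id id₁)

  -- By `exchange-unique` each abstract transposition acts as a concrete one, so `even-induction`
  -- leaves only products of two concrete transpositions.
  complete-if-pairs : ∀ {n} .{{_ : NonZero n}} →
    (∀ {u v x y : Vec A n} → u ≢ v → x ≢ y → Generated (transposition u v ↔-∘ transposition x y)) →
    Complete n
  complete-if-pairs pairs = even-induction Generated generated-cong generated-id generated-∘
    λ s t s-tr t-tr →
      let module s = IsTransposition s-tr
          module t = IsTransposition t-tr
      in generated-cong (transposition s.i s.j ↔-∘ transposition t.i t.j) (s ↔-∘ t)
           (λ z → sym (trans (cong (to s) (exchange-unique t.i↦j t.j↦i t.fixes z))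
                             (exchange-unique s.i↦j s.j↦i s.fixes _)))
           (pairs s.i≢j t.i≢j)

  -- From arity `suc j` to arity `suc j + 1`

  module Step (j : ℕ) (other : ∀ (x : A) → ∃[ y ] x ≢ y)
    (fresh : ∀ (k l m : Vec A j) → ∃[ n ] n ≢ k × n ≢ l × n ≢ m)
    (complete : Complete (suc j)) where

    open Words A j

    module Base {x x′ y y′ : A} {k l m : Vec A j} (k≢l : k ≢ l) (k≢m : k ≢ m) (l≢m : l ≢ m) where

      s u v : Vec A (suc j + 1)
      s = word x k y
      u = word x l y′
      v = word x′ m y

      -- The third point of each cycle repeats the middle part of the second with another letter.
      -- Hence `F` moves only words with middle `l`, or middle `k` and last letter `y`; `G` only
      -- those with middle `m`, or middle `k` and first letter `x`. As `k`, `l`, `m` are distinct,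
      -- only `s` is moved by both.
      module f = ThreeCycle (_≟ᵛ_ {suc j}) {y ∷ k} {y′ ∷ l} {proj₁ (other y′) ∷ l}
        (k≢l ∘ ∷-injectiveʳ) (k≢l ∘ ∷-injectiveʳ) (proj₂ (other y′) ∘ ∷-injectiveˡ)
      module g = ThreeCycle (_≟ᵛ_ {suc j}) {x ∷ k} {x′ ∷ m} {proj₁ (other x′) ∷ m}
        (k≢m ∘ ∷-injectiveʳ) (k≢m ∘ ∷-injectiveʳ) (proj₂ (other x′) ∘ ∷-injectiveˡ)

      F G : Sym (Vec A (suc j + 1))
      F = omitFirst f.3-cycle
      G = omitLast g.3-cycle

      F-generated : Generated F
      F-generated = ext {f = f.3-cycle} 1 ends (complete _ f.3-cycle-isEven)

      G-generated : Generated G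
      G-generated = ext {f = g.3-cycle} 1 Perm.id (complete _ g.3-cycle-isEven)

      F⁻¹-generated : Generated (↔-sym F)
      F⁻¹-generated = generated-cong (omitFirst (↔-sym f.3-cycle)) (↔-sym F) (λ _ → refl)
        (ext {f = ↔-sym f.3-cycle} 1 ends (complete _ f.3-cycle⁻¹-isEven))

      G⁻¹-generated : Generated (↔-sym G)
      G⁻¹-generated = generated-cong (omitLast (↔-sym g.3-cycle)) (↔-sym G) (λ _ → refl)
        (ext {f = ↔-sym g.3-cycle} 1 Perm.id (complete _ g.3-cycle⁻¹-isEven))

      Fs≡u : to F s ≡ u
      Fs≡u = omitFirst-acts f.3-cycle x f.p↦q

      Gs≡v : to G s ≡ v
      Gs≡v = omitLast-acts g.3-cycle y g.p↦q

      u≢s : u ≢ s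
      u≢s eq = k≢l (sym (proj₁ (proj₂ (word-injective eq))))

      v≢s : v ≢ s
      v≢s eq = k≢m (sym (proj₁ (proj₂ (word-injective eq))))

      u≢v : u ≢ v
      u≢v eq = l≢m (proj₁ (proj₂ (word-injective eq)))

      F-moves : ∀ (c : A) (n : Vec A j) (d : A) →
                to F (word c n d) ≡ word c n d ⊎ (n ≡ k × d ≡ y) ⊎ n ≡ l
      F-moves c n d with f.3-cycle-moves (d ∷ n)
      ... | inj₁ eq                 = inj₁ (omitFirst-acts f.3-cycle c eq)
      ... | inj₂ (inj₁ refl)        = inj₂ (inj₁ (refl , refl))
      ... | inj₂ (inj₂ (inj₁ refl)) = inj₂ (inj₂ refl)
      ... | inj₂ (inj₂ (inj₂ refl)) = inj₂ (inj₂ refl)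

      G-moves : ∀ (c : A) (n : Vec A j) (d : A) →
                to G (word c n d) ≡ word c n d ⊎ (n ≡ k × c ≡ x) ⊎ n ≡ m
      G-moves c n d with g.3-cycle-moves (c ∷ n)
      ... | inj₁ eq                 = inj₁ (omitLast-acts g.3-cycle d eq)
      ... | inj₂ (inj₁ refl)        = inj₂ (inj₁ (refl , refl))
      ... | inj₂ (inj₂ (inj₁ refl)) = inj₂ (inj₂ refl)
      ... | inj₂ (inj₂ (inj₂ refl)) = inj₂ (inj₂ refl)

      meet : ∀ (z : Vec A (suc j + 1)) → to F z ≡ z ⊎ to G z ≡ z ⊎ z ≡ s
      meet z with isWord z
      ... | is-word c n d with F-moves c n d | G-moves c n d
      ... | inj₁ fixed                | _                         = inj₁ fixed
      ... | _                         | inj₁ fixed                = inj₂ (inj₁ fixed)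
      ... | inj₂ (inj₁ (refl , refl)) | inj₂ (inj₁ (_ , refl))    = inj₂ (inj₂ refl)
      ... | inj₂ (inj₁ (refl , _))    | inj₂ (inj₂ k≡m)           = contradiction k≡m k≢m
      ... | inj₂ (inj₂ refl)          | inj₂ (inj₁ (l≡k , _))     = contradiction (sym l≡k) k≢l
      ... | inj₂ (inj₂ refl)          | inj₂ (inj₂ l≡m)           = contradiction l≡m l≢m

      swap-meet : ∀ (z : Vec A (suc j + 1)) → to G z ≡ z ⊎ to F z ≡ z ⊎ z ≡ s
      swap-meet z with meet z
      ... | inj₁ eq        = inj₂ (inj₁ eq)
      ... | inj₂ (inj₁ eq) = inj₁ eq
      ... | inj₂ (inj₂ eq) = inj₂ (inj₂ eq)

      su-uv : Generated (transposition s u ↔-∘ transposition u v)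
      su-uv = commutator-generated F G F-generated F⁻¹-generated G-generated G⁻¹-generated
        meet Fs≡u Gs≡v u≢s v≢s

      -- Exchanging `F` and `G` inverts the commutator, which gives the opposite orientation of the
      -- 3-cycle.
      sv-vu : Generated (transposition s v ↔-∘ transposition v u)
      sv-vu = commutator-generated G F G-generated G⁻¹-generated F-generated F⁻¹-generated
        swap-meet Gs≡v Fs≡u v≢s u≢s

      base : u — v ~ s — u × u — v ~ s — v
      base = triangle u≢s v≢s u≢v su-uv sv-vu

    -- Two base triangles share the edge from `word x k y` to `word x′ m y`, with `k` avoiding `l`,
    -- `m` and `n`. The resulting edge no longer depends on `x`, `l` or `y′`.
    base-edge : ∀ {x x′ y y′ l m n} → l ≢ m → n ≢ m →
                word x l y′ — word x′ m y ~ word x′ n y — word x′ m y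
    base-edge {x} {x′} {y} {y′} {l} {m} {n} l≢m n≢m
      with k , k≢l , k≢m , k≢n ← fresh l m n =
      ~-trans (~-sym (~-flip (~-sym (proj₂ (Base.base {x} {x′} {y} {y′} k≢l k≢m l≢m)))))
              (proj₁ (Base.base {x′} {x} {y} {y} n≢m (≢-sym k≢n) (≢-sym k≢m)))

    -- Both edges are linked to the one from `word x′ k y′` to `word x′ m y′`, for any `k` other
    -- than `m`.
    shared-vertex : ∀ {x l y x′ m y′ x″ n y″} → l ≢ m → n ≢ m →
                    word x l y — word x′ m y′ ~ word x″ n y″ — word x′ m y′
    shared-vertex {m = m} l≢m n≢m with k , k≢m , _ ← fresh m m m =
      ~-trans (base-edge l≢m k≢m) (~-sym (base-edge n≢m k≢m))

    -- The edge pivots about `word x′ m y′`, then `word x k y`, then `word z′ o t′`. Taking `k`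
    -- different from `m` and `o` keeps the middle parts distinct throughout.
    apart : ∀ {x l y x′ m y′ z n t z′ o t′} → l ≢ m → n ≢ o →
            word x l y — word x′ m y′ ~ word z n t — word z′ o t′
    apart {x} {l} {y} {x′} {m} {y′} {o = o} l≢m n≢o with k , k≢m , k≢o , _ ← fresh m o o =
      ~-trans (shared-vertex {x″ = x} {n = k} {y″ = y} l≢m k≢m)
        (~-trans (~-flip (shared-vertex (≢-sym k≢m) (≢-sym k≢o)))
          (~-flip (shared-vertex k≢o n≢o)))

    complete-suc : Complete (suc j + 1)
    complete-suc = complete-if-pairs pairs
      where
      module _ {z t z′ t′ : A} {n o : Vec A j} (n≢o : n ≢ o) where
        distinct : ∀ {u v} → u ≢ v → u — v ~ word z n t — word z′ o t′
        distinct {u} {v} u≢v with isWord u | isWord v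
        ... | is-word x l y | is-word x′ m y′ with l ≟ᵛ m
        ... | no l≢m   = apart l≢m n≢o
        -- Equal middle parts: go through `w = word x k y`, whose edges to `u` and `v` both have
        -- distinct middle parts.
        ... | yes refl with k , k≢m , _ ← fresh m m m =
          ~-trans (detour (≢-sym u≢v) v≢w (apart (≢-sym k≢m) k≢m)) (apart (≢-sym k≢m) n≢o)
          where
          v≢w : word x′ m y′ ≢ word x k y
          v≢w eq = k≢m (sym (proj₁ (proj₂ (word-injective eq))))

      pairs : ∀ {u v u′ v′} → u ≢ v → u′ ≢ v′ →
              Generated (transposition u v ↔-∘ transposition u′ v′)
      pairs {u} u≢v u′≢v′ with isWord u
      -- Both transpositions are linked to a common reference edge from `word x l y` to
      -- `word x k y`.
      ... | is-word x l y with k , k≢l , _ ← fresh l l l =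
        proj₁ (~-trans (distinct {x} {y} {x} {y} (≢-sym k≢l) u≢v)
                       (~-sym (distinct (≢-sym k≢l) u′≢v′)))

  -- Induction on the arity, starting at 4

  distinct-letters : ∀ {n} {u v : Vec A n} → u ≢ v → ∃₂ λ (x y : A) → x ≢ y
  distinct-letters {u = []}    {[]}    u≢v = contradiction refl u≢v
  distinct-letters {u = x ∷ u} {y ∷ v} u≢v with x ≟ y
  ... | no x≢y   = x , y , x≢y
  ... | yes refl = distinct-letters (u≢v ∘ cong (x ∷_))

  module _ {x₀ y₀ : A} (x₀≢y₀ : x₀ ≢ y₀) where

    other-letter : ∀ x → ∃[ y ] x ≢ y
    other-letter x with x ≟ x₀
    ... | yes refl = y₀ , x₀≢y₀
    ... | no x≢x₀  = x₀ , x≢x₀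

    -- A diagonal choice: it differs from `k` in the first letter, from `l` in the second and from
    -- `m` in the third. The three positions needed in the middle part make the induction start at
    -- arity 4.
    fresh-vector : ∀ {i} (k l m : Vec A (3 + i)) → ∃[ n ] n ≢ k × n ≢ l × n ≢ m
    fresh-vector k@(x ∷ _) l@(_ ∷ y ∷ _) m@(_ ∷ _ ∷ z ∷ ms) =
      proj₁ (other-letter x) ∷ proj₁ (other-letter y) ∷ proj₁ (other-letter z) ∷ ms ,
      (λ eq → proj₂ (other-letter x) (sym (∷-injectiveˡ eq))) ,
      (λ eq → proj₂ (other-letter y) (sym (∷-injectiveˡ (∷-injectiveʳ eq)))) ,
      (λ eq → proj₂ (other-letter z) (sym (∷-injectiveˡ (∷-injectiveʳ (∷-injectiveʳ eq)))))

  complete-step : ∀ i → Complete (4 + i) → Complete (5 + i)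
  -- Reducing to pairs first supplies distinct words, and from them two distinct letters. Over an
  -- alphabet with fewer letters there are no transpositions to treat.
  complete-step i complete = complete-if-pairs λ {u} {v} {x} {y} u≢v x≢y →
    let _ , _ , x₀≢y₀ = distinct-letters u≢v
    in complete-subst (+-comm (4 + i) 1)
         (Step.complete-suc (3 + i) (other-letter x₀≢y₀) (fresh-vector x₀≢y₀) complete)
         _ (pair-isEven (transposition-isTransposition u≢v) (transposition-isTransposition x≢y))

  complete-≥4 : Complete 4 → ∀ i → Complete (4 + i)
  complete-≥4 complete zero    = complete
  complete-≥4 complete (suc i) = complete-step i (complete-≥4 complete i)

  Alt⊆⌈⌉ : Complete 4 → ∀ n → 4 ≤ n → Alt A n ⊆ ⌈ P ⌉
  Alt⊆⌈⌉ complete n 4≤n {gate _ f} (refl , f-even) with i , refl ← m≤n⇒∃[o]m+o≡n 4≤n =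
    complete-≥4 complete i f f-even

-- Finite alphabets: generated gates are even, and a finite generating list

module Finite {a} {A : Set a} {k} (A↔Fin : A ↔ Fin k) where

  _≟_ : DecidableEquality A
  _≟_ = Fin.inj⇒≟ (↔⇒↣ A↔Fin)

  letters : List A
  letters = map (from A↔Fin) (allFin k)

  letters-unique : Unique letters
  letters-unique = Unique.map⁺ (to-injective (↔-sym A↔Fin)) (Unique.allFin⁺ k)

  letters-complete : ∀ x → x List.∈ letters
  letters-complete x = subst (List._∈ letters) (strictlyInverseʳ A↔Fin x)
    (∈-map⁺ (from A↔Fin) (∈-allFin (to A↔Fin x)))

  vectors : ∀ n → List (Vec A n)
  vectors zero    = [] ∷ []
  vectors (suc n) = cartesianProductWith _∷_ letters (vectors n)

  vectors-unique : ∀ n → Unique (vectors n)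
  vectors-unique zero    = [] ∷ []
  vectors-unique (suc n) = Unique.cartesianProductWith⁺ _∷_ ∷-injective
    letters-unique (vectors-unique n)

  vectors-complete : ∀ {n} (v : Vec A n) → v List.∈ vectors n
  vectors-complete []      = here refl
  vectors-complete (x ∷ v) = ∈-cartesianProductWith⁺ _∷_ (letters-complete x) (vectors-complete v)

  extend-even : ∀ {ℓ} k α (f : Sym (Vec A ℓ)) → IsEven f → IsEven (extend k α f)
  extend-even k α f = parallel-even (extend k α f) f (extend-acts k α f)
    where open Parallel (≡-dec _≟_) (extended k α) (extended-injective k α)
            (extended-surjective k α) (vectors k) (vectors-unique k) vectors-complete

  ⌈⌉-even : ∀ {p} {P : Pred (Gate A) p} → (∀ {g} → g ∈ P → IsEven (perm g)) →
            ∀ {g} → g ∈ ⌈ P ⌉ → IsEven (perm g)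
  ⌈⌉-even P-even id₁                        = even-id
  ⌈⌉-even P-even (gen g∈P)                  = P-even g∈P
  ⌈⌉-even P-even (comp {f = f} {g} f∈ g∈)   = even-∘ {f = f} {g} (⌈⌉-even P-even f∈) (⌈⌉-even P-even g∈)
  ⌈⌉-even P-even (ext {f = f} k α f∈)       = extend-even k α f (⌈⌉-even P-even f∈)
  ⌈⌉-even P-even (resp (same {f = f} {g} f≗g) f∈) = even-cong {f = f} {g} f≗g (⌈⌉-even P-even f∈)

  open module SwapVec {n} = Swap {X = Vec A n} (≡-dec _≟_)

  distinctPairs : ∀ n → List (Vec A n × Vec A n)
  distinctPairs n =
    filter (λ (u , v) → ¬? (≡-dec _≟_ u v)) (cartesianProduct (vectors n) (vectors n))

  distinctPairs-sound : ∀ {n} {u v : Vec A n} → (u , v) List.∈ distinctPairs n → u ≢ v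
  distinctPairs-sound {n} uv∈ =
    proj₂ (∈-filter⁻ _ {xs = cartesianProduct (vectors n) (vectors n)} uv∈)

  pairGate : ∀ {n} .{{_ : NonZero n}} → Vec A n × Vec A n → Vec A n × Vec A n → Gate A
  pairGate (u , v) (x , y) = gate _ (transposition u v ↔-∘ transposition x y)

  pairGates : ∀ n → .{{NonZero n}} → List (Gate A)
  pairGates n = cartesianProductWith pairGate (distinctPairs n) (distinctPairs n)

  distinctPairs-complete : ∀ {n} {u v : Vec A n} → u ≢ v → (u , v) List.∈ distinctPairs n
  distinctPairs-complete u≢v =
    ∈-filter⁺ _ (∈-cartesianProduct⁺ (vectors-complete _) (vectors-complete _)) u≢v

  pairGates-even : ∀ n .{{_ : NonZero n}} {g} → g List.∈ pairGates n → IsEven (perm g)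
  pairGates-even n g∈
    with _ , _ , uv∈ , xy∈ , refl
         ← ∈-cartesianProductWith⁻ pairGate (distinctPairs n) (distinctPairs n) g∈ =
    pair-isEven (transposition-isTransposition (distinctPairs-sound uv∈))
                (transposition-isTransposition (distinctPairs-sound xy∈))


  pairGates-complete : ∀ {n} .{{_ : NonZero n}} {u v x y : Vec A n} → u ≢ v → x ≢ y →
                       gate n (transposition u v ↔-∘ transposition x y) List.∈ pairGates n
  pairGates-complete u≢v x≢y =
    ∈-cartesianProductWith⁺ pairGate (distinctPairs-complete u≢v) (distinctPairs-complete x≢y)

  -- Arities 1 to 4, since `upTo 4` lists 0 to 3. The arities below 4 need generators of their own
  -- because extension never lowers the arity.
  generators : List (Gate A)
  generators = concatMap (λ n → pairGates (suc n)) (upTo 4)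

  open Membership (gateSetoid A) using () renaming (_∈_ to _∈ₗ_)

  generators-even : ∀ {g} → g ∈ₗ generators → IsEven (perm g)
  generators-even g∈ with find g∈
  ... | h , h∈ , g≈h with find (∈-concatMap⁻ (λ n → pairGates (suc n)) {xs = upTo 4} h∈)
  ... | n , _ , h∈n with g≈h | pairGates-even (suc n) h∈n
  ... | same {f = f} {g} f≗g | g-even = even-cong {f = g} {f} (λ x → sym (f≗g x)) g-even

  open Generation _≟_ {P = _∈ₗ generators} using (Complete; complete-if-pairs; complete-≥4)

  complete-≤4 : ∀ n → n < 4 → Complete (suc n)
  complete-≤4 n n<4 = complete-if-pairs λ u≢v x≢y → gen
    (lose (∈-concatMap⁺ (λ n → pairGates (suc n))
            (lose (∈-upTo⁺ n<4) (pairGates-complete u≢v x≢y)))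
          (Setoid.refl (gateSetoid A)))

  even-generated : ∀ n .{{_ : NonZero n}} → Complete n
  even-generated (suc n) with n <? 4
  ... | yes n<4 = complete-≤4 n n<4
  ... | no n≮4 with i , refl ← m≤n⇒∃[o]m+o≡n (≮⇒≥ n≮4) =
    -- Here `n` is `4 + i`, so the arity `suc n` is `4 + suc i`; the base case is arity 4, the
    -- successor of 3.
    complete-≥4 (complete-≤4 3 (s≤s (s≤s (s≤s (s≤s z≤n))))) (suc i)

  finitelyGenerated : FinitelyGenerated (Even A)
  finitelyGenerated = generators ,
    (λ {g} g∈ → arity g , refl , ⌈⌉-even generators-even g∈) ,
    λ { {gate n f} (_ , refl , f-even) → even-generated n f f-even }

theorem20 : ∀ {a} {A : Set a} {k : ℕ} → A ↔ Fin k →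
    FinitelyGenerated (Even A) × (∀ n → 4 ≤ n → Alt A n ⊆ ⌈ Alt A 4 ⌉)
-- With `Alt A 4` as generating set, completeness in arity 4 is immediate from `gen`, and the same
-- induction on the arity applies.
theorem20 {A = A} A↔Fin = finitelyGenerated , Alt⊆⌈⌉ λ f f-even → gen (refl , f-even)
  where
  open Finite A↔Fin
  open Generation _≟_ {P = Alt A 4} using (Alt⊆⌈⌉)
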